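{- Let $(\mathcal{P}_1,\mathcal{L}_1)$ and $(\mathcal{P}_2,\mathcal{L}_2)$ be two $(n_s,m_k)$-configurations with disjoint point sets, and consider a connected sum of them. Its point set is partitioned into the points $\mathcal{P}_1$ of the first configuration and the points $\mathcal{P}_2$ of the second. Then no triangle of the connected sum has points from both $\mathcal{P}_1$ and $\mathcal{P}_2$.
   Context: An $(n_s,m_k)$-configuration is a pair $(\mathcal{P},\mathcal{L})$ with $\mathcal{P}$ a set of $n\geq 3$ points and $\mathcal{L}$ a set of $m$ subsets of $\mathcal{P}$ called lines, such that any two distinct points lie together on at most one line, every point is on exactly $s$ lines, and every line contains exactly $k$ points. Three points $p_1,p_2,p_3$ form a triangle if there are lines $l_1,l_2,l_3$ with $p_1,p_2\in l_1$, $p_3\notin l_1$; $p_2,p_3\in l_2$, $p_1\notin l_2$; $p_1,p_3\in l_3$, $p_2\notin l_3$. A connected sum of two $(n_s,m_k)$-configurations $(\mathcal{P}_1,\mathcal{L}_1)$, $(\mathcal{P}_2,\mathcal{L}_2)$ (with disjoint point sets) is the $(2n_s,2m_k)$-configuration (that is, with $2n$ points and $2m$ lines, $s$ lines per point and $k$ points per line) obtained as follows: choose a point $p_1\in\mathcal{P}_1$ on a line $l_1\in\mathcal{L}_1$ and a point $p_2\in\mathcal{P}_2$ on a line $l_2\in\mathcal{L}_2$; take the point set $\mathcal{P}_1\cup\mathcal{P}_2$ and the lines $\mathcal{L}_1\cup\mathcal{L}_2$, except that $l_1$ is replaced by $(l_1\setminus\{p_1\})\cup\{p_2\}$ and $l_2$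 by $(l_2\setminus\{p_2\})\cup\{p_1\}$. The result may depend on the choices. -}

module Defs where

open import Data.Bool.Properties using () renaming (_≟_ to _≟ᵇ_)
open import Data.Fin using (Fin)
open import Data.Fin.Subset using (Subset; _∈_; _∉_; _⊆_; _∪_; _-_; ⁅_⁆; ∣_∣)
open import Data.Fin.Subset.Properties using (_∈?_)
open import Data.List using (List; length; map; filter; _++_)
open import Data.List.Membership.Propositional using () renaming (_∈_ to _∈ˡ_)
open import Data.List.Relation.Unary.Unique.Propositional using (Unique)
open import Data.Nat using (ℕ; _≤_)
open import Data.Product using (_×_; ∃-syntax)
open import Data.Sum using (_⊎_)
open import Data.Vec.Properties using (≡-dec)
open import Relation.Binary.Definitions using (DecidableEquality)
open import Relation.Binary.PropositionalEquality using (_≡_; _≢_)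
open import Relation.Nullary using (yes; no)

-- Points are drawn from a finite universe Fin u, so that the point sets of two
-- structures over the same universe may be disjoint, and unions of point sets
-- and lines are literal unions of subsets.  The list of lines stands for a
-- finite set; that it has no repetitions is required in IsConfiguration.
record PointLine (u : ℕ) : Set where
  field
    points : Subset u
    lines  : List (Subset u)

open PointLine public

record IsConfiguration {u : ℕ} (C : PointLine u) (n s m k : ℕ) : Set where
  field
    n≥3            : 3 ≤ n
    #points        : ∣ points C ∣ ≡ n
    lines-unique   : Unique (lines C)
    #lines         : length (lines C) ≡ m
    lines⊆points   : ∀ {l} → l ∈ˡ lines C → l ⊆ points C
    ≤1-joining     : ∀ {p q} → p ∈ points C → q ∈ points C → p ≢ q →
                     ∀ {l l′} → l ∈ˡ lines C → l′ ∈ˡ lines C →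
                     p ∈ l → q ∈ l → p ∈ l′ → q ∈ l′ → l ≡ l′
    #lines-through : ∀ {p} → p ∈ points C →
                     length (filter (p ∈?_) (lines C)) ≡ s
    #points-on     : ∀ {l} → l ∈ˡ lines C → ∣ l ∣ ≡ k

record IsTriangle {u : ℕ} (C : PointLine u) (p₁ p₂ p₃ : Fin u) : Set where
  field
    p₁∈   : p₁ ∈ points C
    p₂∈   : p₂ ∈ points C
    p₃∈   : p₃ ∈ points C
    side₁ : ∃[ l₁ ] (l₁ ∈ˡ lines C × p₁ ∈ l₁ × p₂ ∈ l₁ × p₃ ∉ l₁)
    side₂ : ∃[ l₂ ] (l₂ ∈ˡ lines C × p₂ ∈ l₂ × p₃ ∈ l₂ × p₁ ∉ l₂)
    side₃ : ∃[ l₃ ] (l₃ ∈ˡ lines C × p₁ ∈ l₃ × p₃ ∈ l₃ × p₂ ∉ l₃)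

_≟ˢ_ : ∀ {u} → DecidableEquality (Subset u)
_≟ˢ_ = ≡-dec _≟ᵇ_

replace : ∀ {u} → Subset u → Subset u → Subset u → Subset u
replace old new l with l ≟ˢ old
... | yes _ = new
... | no  _ = l

-- Meaningful when pᵢ ∈ lᵢ, lᵢ is a line of Cᵢ, and the point sets are disjoint.
connectedSum : ∀ {u} (C₁ C₂ : PointLine u)
               (p₁ : Fin u) (l₁ : Subset u) (p₂ : Fin u) (l₂ : Subset u) →
               PointLine u
connectedSum C₁ C₂ p₁ l₁ p₂ l₂ = record
  { points = points C₁ ∪ points C₂
  ; lines  = map (replace l₁ ((l₁ - p₁) ∪ ⁅ p₂ ⁆)) (lines C₁) ++
             map (replace l₂ ((l₂ - p₂) ∪ ⁅ p₁ ⁆)) (lines C₂)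
  }

HasPointIn : ∀ {u} → Subset u → (a b c : Fin u) → Set
HasPointIn P a b c = a ∈ P ⊎ b ∈ P ⊎ c ∈ P

{-# OPTIONS --safe #-}
-- A line of the connected sum meeting both point sets must be one of the two
-- rerouted lines (l₁ ∖ p₁) ∪ {p₂} and (l₂ ∖ p₂) ∪ {p₁}, and these are disjoint.
-- In a triangle with points from both sets, one vertex is alone on its side, so
-- the two sides of the triangle through it are such lines with a common point.
-- They coincide, contradicting that each of them misses a vertex of the other.
module Submission where

open import Defs
open import Data.Fin using (Fin; zero; suc)
open import Data.Fin.Subset using (Subset; _∈_; _∉_; _⊆_; _∩_; _∪_; _-_; ⁅_⁆; Empty)
open import Data.Fin.Subset.Properties
  using (x∈p∩q⁺; x∈p∪q⁻; x∈⁅y⁆⇒x≡y; p─q⊆p)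
open import Data.List using (List; map)
open import Data.List.Membership.Propositional using () renaming (_∈_ to _∈ˡ_)
open import Data.List.Membership.Propositional.Properties using (∈-map⁻; ∈-++⁻)
open import Data.Nat using (ℕ)
open import Data.Product using (_×_; _,_; ∃-syntax)
open import Data.Sum using (_⊎_; inj₁; inj₂; [_,_])
open import Data.Vec using (_∷_; there)
open import Relation.Nullary using (¬_; yes; no; contradiction)
open import Relation.Binary.PropositionalEquality using (_≡_; refl; sym; trans; subst)

private
  variable
    u n s m k : ℕ

x∉p-x : ∀ (p : Subset u) x → x ∉ p - x
x∉p-x (_ ∷ p) zero    ()
x∉p-x (_ ∷ p) (suc x) (there x∈) = x∉p-x p x x∈

∈-map-replace⁻ : ∀ {old new l : Subset u} (ls : List (Subset u)) →
                 l ∈ˡ map (replace old new) ls → l ≡ new ⊎ l ∈ˡ ls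
∈-map-replace⁻ {old = old} {new} ls l∈ with ∈-map⁻ (replace old new) l∈
... | l′ , l′∈ , eq with l′ ≟ˢ old
...   | yes _ = inj₁ eq
...   | no  _ = inj₂ (subst (_∈ˡ ls) (sym eq) l′∈)

-- Unfolds to the replacement lines written out in `connectedSum`, so facts about it apply there
-- directly.
reroute : Subset u → Fin u → Fin u → Subset u
reroute l p q = (l - p) ∪ ⁅ q ⁆

∈-reroute⁻ : ∀ (l : Subset u) p q {x} → x ∈ reroute l p q → x ∈ l - p ⊎ x ≡ q
∈-reroute⁻ l p q x∈ with x∈p∪q⁻ (l - p) ⁅ q ⁆ x∈
... | inj₁ x∈l-p = inj₁ x∈l-p
... | inj₂ x∈⁅q⁆ = inj₂ (x∈⁅y⁆⇒x≡y q x∈⁅q⁆)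

-- Each rerouted line gains exactly the point that the other one loses, and its remaining points
-- stay on its own side.
reroutes-disjoint : ∀ {P Q l₁ l₂ : Subset u} {p₁ p₂} → Empty (P ∩ Q) →
                    l₁ ⊆ P → p₁ ∈ l₁ → l₂ ⊆ Q → p₂ ∈ l₂ →
                    ∀ {x} → x ∈ reroute l₁ p₁ p₂ → x ∉ reroute l₂ p₂ p₁
reroutes-disjoint {l₁ = l₁} {l₂} {p₁} {p₂} P∩Q=∅ l₁⊆P p₁∈l₁ l₂⊆Q p₂∈l₂ x∈ x∈′
  with ∈-reroute⁻ l₁ p₁ p₂ x∈ | ∈-reroute⁻ l₂ p₂ p₁ x∈′
... | inj₁ x∈₁  | inj₁ x∈₂  =
  P∩Q=∅ (_ , x∈p∩q⁺ (l₁⊆P (p─q⊆p l₁ _ x∈₁) , l₂⊆Q (p─q⊆p l₂ _ x∈₂)))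
... | inj₁ x∈₁  | inj₂ refl = x∉p-x l₁ p₁ x∈₁
... | inj₂ refl | inj₁ x∈₂  = x∉p-x l₂ p₂ x∈₂
-- Here the two exchanged points would be equal, giving a point common to `P` and `Q`.
... | inj₂ refl | inj₂ refl = P∩Q=∅ (_ , x∈p∩q⁺ (l₁⊆P p₁∈l₁ , l₂⊆Q p₂∈l₂))

module _ (C₁ C₂ : PointLine u)
         (I₁ : IsConfiguration C₁ n s m k) (I₂ : IsConfiguration C₂ n s m k)
         (disjoint : Empty (points C₁ ∩ points C₂))
         {p₁ : Fin u} {l₁ : Subset u} (l₁∈ : l₁ ∈ˡ lines C₁) (p₁∈ : p₁ ∈ l₁)
         {p₂ : Fin u} {l₂ : Subset u} (l₂∈ : l₂ ∈ˡ lines C₂) (p₂∈ : p₂ ∈ l₂)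
  where

  open IsConfiguration using (lines⊆points)
  open IsTriangle using (side₁; side₂; side₃)

  private
    C = connectedSum C₁ C₂ p₁ l₁ p₂ l₂

  -- A line that was not replaced is still a line of its own summand, so it lies within that
  -- summand's points and cannot reach the other side.
  crossing⇒rerouted : ∀ {l x y} → l ∈ˡ lines C →
                      x ∈ points C₁ → x ∈ l → y ∈ points C₂ → y ∈ l →
                      l ≡ reroute l₁ p₁ p₂ ⊎ l ≡ reroute l₂ p₂ p₁
  crossing⇒rerouted l∈ x∈₁ x∈l y∈₂ y∈l
    with ∈-++⁻ (map (replace l₁ (reroute l₁ p₁ p₂)) (lines C₁)) l∈
  ... | inj₁ l∈₁ with ∈-map-replace⁻ (lines C₁) l∈₁
  ...   | inj₁ l≡   = inj₁ l≡
  ...   | inj₂ l∈C₁ =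
    contradiction (_ , x∈p∩q⁺ (lines⊆points I₁ l∈C₁ y∈l , y∈₂)) disjoint
  crossing⇒rerouted l∈ x∈₁ x∈l y∈₂ y∈l
      | inj₂ l∈₂ with ∈-map-replace⁻ (lines C₂) l∈₂
  ...   | inj₁ l≡   = inj₂ l≡
  ...   | inj₂ l∈C₂ =
    contradiction (_ , x∈p∩q⁺ (x∈₁ , lines⊆points I₂ l∈C₂ x∈l)) disjoint

  -- Symmetric in the two summands, so that a lone vertex may lie on either side.
  Opposite : Fin u → Fin u → Set
  Opposite x y = (x ∈ points C₁ × y ∈ points C₂) ⊎ (y ∈ points C₁ × x ∈ points C₂)

  opposite⇒rerouted : ∀ {l x y} → Opposite x y → l ∈ˡ lines C → x ∈ l → y ∈ l →
                      l ≡ reroute l₁ p₁ p₂ ⊎ l ≡ reroute l₂ p₂ p₁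
  opposite⇒rerouted (inj₁ (x∈₁ , y∈₂)) l∈ x∈ y∈ = crossing⇒rerouted l∈ x∈₁ x∈ y∈₂ y∈
  opposite⇒rerouted (inj₂ (y∈₁ , x∈₂)) l∈ x∈ y∈ = crossing⇒rerouted l∈ y∈₁ y∈ x∈₂ x∈

  -- Only two lines can cross, and they are disjoint; sharing `z` therefore forces `l` and `l′` to
  -- be the same one.
  crossing-unique : ∀ {l l′ x y z} → Opposite x z → Opposite y z →
                    l ∈ˡ lines C → x ∈ l → z ∈ l →
                    l′ ∈ˡ lines C → y ∈ l′ → z ∈ l′ → l ≡ l′
  crossing-unique xz yz l∈ x∈l z∈l l′∈ y∈l′ z∈l′
    with reroutes-disjoint disjoint (lines⊆points I₁ l₁∈) p₁∈ (lines⊆points I₂ l₂∈) p₂∈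
       | opposite⇒rerouted xz l∈ x∈l z∈l | opposite⇒rerouted yz l′∈ y∈l′ z∈l′
  ... | _       | inj₁ l≡   | inj₁ l′≡  = trans l≡ (sym l′≡)
  ... | _       | inj₂ l≡   | inj₂ l′≡  = trans l≡ (sym l′≡)
  ... | r₁∩r₂=∅ | inj₁ refl | inj₂ refl = contradiction z∈l′ (r₁∩r₂=∅ z∈l)
  ... | r₁∩r₂=∅ | inj₂ refl | inj₁ refl = contradiction z∈l (r₁∩r₂=∅ z∈l′)

  -- The shape of the side fields of `IsTriangle`, indexed first by the vertex that the side avoids.
  SideMissing : Fin u → Fin u → Fin u → Set
  SideMissing z x y = ∃[ l ] (l ∈ˡ lines C × x ∈ l × y ∈ l × z ∉ l)

  reverse : ∀ {x y z} → SideMissing z x y → SideMissing z y x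
  reverse (l , l∈ , x∈l , y∈l , z∉l) = l , l∈ , y∈l , x∈l , z∉l

  -- With `z` alone on its side, the two sides through `z` both cross and hence coincide; but the
  -- first avoids `y` and the second contains it.
  no-isolated-vertex : ∀ {x y z} → Opposite x z → Opposite y z →
                       SideMissing y x z → ¬ SideMissing x y z
  no-isolated-vertex xz yz (_ , l∈ , x∈l , z∈l , y∉l) (_ , l′∈ , y∈l′ , z∈l′ , _)
    with refl ← crossing-unique xz yz l∈ x∈l z∈l l′∈ y∈l′ z∈l′ = y∉l y∈l′

  triangle-unmixed : ∀ {a b c} → IsTriangle C a b c →
                     ¬ (HasPointIn (points C₁) a b c × HasPointIn (points C₂) a b c)
  triangle-unmixed T (in₁ , in₂)
    with x∈p∪q⁻ (points C₁) _ (IsTriangle.p₁∈ T)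
       | x∈p∪q⁻ (points C₁) _ (IsTriangle.p₂∈ T)
       | x∈p∪q⁻ (points C₁) _ (IsTriangle.p₃∈ T)
  -- All vertices lie in one summand, so any vertex in the other contradicts disjointness.
  ... | inj₁ a∈ | inj₁ b∈ | inj₁ c∈ = [ clash a∈ , [ clash b∈ , clash c∈ ] ] in₂
    where
    clash : ∀ {x} → x ∈ points C₁ → x ∉ points C₂
    clash x∈₁ x∈₂ = disjoint (_ , x∈p∩q⁺ (x∈₁ , x∈₂))
  ... | inj₂ a∈ | inj₂ b∈ | inj₂ c∈ = [ clash a∈ , [ clash b∈ , clash c∈ ] ] in₁
    where
    clash : ∀ {x} → x ∈ points C₂ → x ∉ points C₁
    clash x∈₂ x∈₁ = disjoint (_ , x∈p∩q⁺ (x∈₁ , x∈₂))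
  -- In the mixed cases the lone vertex is `c`, then `b`, then `a`; sides are reversed where needed
  -- so that it comes last.
  ... | inj₁ a∈ | inj₁ b∈ | inj₂ c∈ =
    no-isolated-vertex (inj₁ (a∈ , c∈)) (inj₁ (b∈ , c∈)) (side₃ T) (side₂ T)
  ... | inj₂ a∈ | inj₂ b∈ | inj₁ c∈ =
    no-isolated-vertex (inj₂ (c∈ , a∈)) (inj₂ (c∈ , b∈)) (side₃ T) (side₂ T)
  ... | inj₁ a∈ | inj₂ b∈ | inj₁ c∈ =
    no-isolated-vertex (inj₁ (a∈ , b∈)) (inj₁ (c∈ , b∈)) (side₁ T) (reverse (side₂ T))
  ... | inj₂ a∈ | inj₁ b∈ | inj₂ c∈ =
    no-isolated-vertex (inj₂ (b∈ , a∈)) (inj₂ (b∈ , c∈)) (side₁ T) (reverse (side₂ T))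
  ... | inj₂ a∈ | inj₁ b∈ | inj₁ c∈ =
    no-isolated-vertex (inj₁ (b∈ , a∈)) (inj₁ (c∈ , a∈)) (reverse (side₁ T)) (reverse (side₃ T))
  ... | inj₁ a∈ | inj₂ b∈ | inj₂ c∈ =
    no-isolated-vertex (inj₂ (a∈ , b∈)) (inj₂ (a∈ , c∈)) (reverse (side₁ T)) (reverse (side₃ T))

proposition5p1 : ∀ {u n s m k : ℕ} (C₁ C₂ : PointLine u) →
    IsConfiguration C₁ n s m k →
    IsConfiguration C₂ n s m k →
    Empty (points C₁ ∩ points C₂) →
    ∀ (p₁ : Fin u) (l₁ : Subset u) → l₁ ∈ˡ lines C₁ → p₁ ∈ l₁ →
    ∀ (p₂ : Fin u) (l₂ : Subset u) → l₂ ∈ˡ lines C₂ → p₂ ∈ l₂ →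
    ∀ (a b c : Fin u) →
    IsTriangle (connectedSum C₁ C₂ p₁ l₁ p₂ l₂) a b c →
    ¬ (HasPointIn (points C₁) a b c × HasPointIn (points C₂) a b c)
proposition5p1 C₁ C₂ I₁ I₂ disjoint _ _ l₁∈ p₁∈ _ _ l₂∈ p₂∈ _ _ _ =
  triangle-unmixed C₁ C₂ I₁ I₂ disjoint l₁∈ p₁∈ l₂∈ p₂∈
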